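{- $n(3)=6$, where $n(k)$ denotes the minimum number of vertices in an oriented $k$-graph with Property O.
   Context: An oriented $k$-graph is a pair $\mathcal{H}=(V,\mathcal{E})$, where $V$ is a finite set (the vertex set) and $\mathcal{E}$ (the edge set) is a family of $k$-tuples of elements of $V$ such that no $k$-tuple in $\mathcal{E}$ has a repeated element, and no two $k$-tuples in $\mathcal{E}$ induce the same set (i.e. distinct $k$-tuples in $\mathcal{E}$ have distinct underlying $k$-element subsets of $V$). A tuple $(x_1,x_2,\ldots,x_\ell)$ of distinct elements of $V$ is said to be consistent with a linear order $<$ on $V$ if $x_1<x_2<\cdots<x_\ell$. An oriented $k$-graph $\mathcal{H}=(V,\mathcal{E})$ has Property O if for every linear order $<$ of $V$ there exists an edge $\vec{e}\in\mathcal{E}$ that is consistent with $<$. For $k\ge 2$, \[ n(k) := \min\{|V| : \text{there exists an oriented } k\text{ -graph } \mathcal{H}=(V,\mathcal{E}) \text{ having Property O}\}. \] -}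

module Defs where

open import Data.Fin.Base using (Fin)
open import Data.Nat.Base using (ℕ; _≤_)
open import Data.Product.Base using (_×_; ∃-syntax; Σ-syntax)
open import Data.Vec.Base using (Vec)
open import Data.Vec.Membership.Propositional using (_∈_)
open import Data.Vec.Relation.Unary.Linked using (Linked)
open import Data.Vec.Relation.Unary.Unique.Propositional using (Unique)
open import Function.Bundles using (_↔_; _⇔_)
open import Level using (0ℓ)
open import Relation.Binary.Core using (Rel)
open import Relation.Binary.PropositionalEquality.Core using (_≡_)
open import Relation.Binary.Structures using (IsStrictTotalOrder)
open import Relation.Unary using (Pred)

SameSet : ∀ {V : Set} {k} → Vec V k → Vec V k → Set
SameSet e f = ∀ x → (x ∈ e) ⇔ (x ∈ f)

-- The edge set is an arbitrary subset of Vᵏ, given by its membership predicate.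
record OrientedGraph (k : ℕ) : Set₁ where
  field
    V               : Set
    size            : ℕ
    finite          : V ↔ Fin size
    IsEdge          : Pred (Vec V k) 0ℓ
    edge-distinct   : ∀ {e} → IsEdge e → Unique e
    edge-determined : ∀ {e f} → IsEdge e → IsEdge f → SameSet e f → e ≡ f

-- Distinctness of the entries is implied, a linear order being irreflexive
-- and transitive.
Consistent : ∀ {V : Set} {ℓ} → Rel V 0ℓ → Vec V ℓ → Set
Consistent _<_ xs = Linked _<_ xs

PropertyO : ∀ {k} → OrientedGraph k → Set₁
PropertyO {k} H = (_<_ : Rel V 0ℓ) → IsStrictTotalOrder _≡_ _<_ →
                  ∃[ e ] IsEdge e × Consistent _<_ e
  where open OrientedGraph H

PropertyOOn : ℕ → ℕ → Set₁
PropertyOOn k m = Σ[ H ∈ OrientedGraph k ] OrientedGraph.size H ≡ m × PropertyO H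

IsMinimum : ∀ {ℓ} → Pred ℕ ℓ → ℕ → Set ℓ
IsMinimum P m = P m × (∀ i → P i → m ≤ i)

-- The assertion n(k) = m.  It is a relation because n, as a function, would
-- presuppose that for every k some oriented k-graph has Property O.
n[_]≡_ : ℕ → ℕ → Set₁
n[ k ]≡ m = IsMinimum (PropertyOOn k) m

{-# OPTIONS --safe #-}

-- Upper bound: an explicit graph with twelve edges, tested against all
-- permutations of the six vertices.
--
-- Lower bound: label the at most five Vec.allFin injectively by Fin 5, so that
-- some edge becomes (0,1,2).  A permutation of Fin 5 orders each of the ten
-- 3-subsets in one of six ways, which makes it a word of length 10 over an
-- alphabet of six letters, and an edge set is at most one letter at each
-- position.  Property O says that each of the 120 words agrees with the edge
-- set somewhere; a backtracking search shows that this is impossible.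
module Submission where

open import Defs

open import Data.Bool.Base using (Bool; true; false; if_then_else_; T)
open import Data.Bool.ListAction using (all)
open import Data.Fin.Base using (Fin; zero; suc; _<_; inject≤; punchIn; punchOut)
open import Data.Fin.Patterns using (0F; 1F; 2F; 3F; 4F; 5F)
open import Data.Fin.Properties
  using (_≟_; _<?_; <-cmp; <-trans; <-irrefl; punchIn-punchOut; inject≤-injective; any?)
  renaming (all? to ∀?)
open import Data.List.Base using (List; []; _∷_; _++_; map; concatMap; allFin)
open import Data.List.Membership.Propositional as List using (find; lose)
open import Data.List.Membership.Propositional.Properties using (∈-allFin)
open import Data.List.Relation.Unary.All as All using (All; []; _∷_; all?)
import Data.List.Relation.Unary.All.Properties as All
open import Data.List.Relation.Unary.Any as Any using (Any; here; there)
import Data.List.Relation.Unary.Any.Properties as Any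
open import Data.Nat.Base using (ℕ; zero; suc; _+_; _≤_; s≤s⁻¹)
open import Data.Nat.Properties using (≮⇒≥)
open import Data.Product.Base using (_×_; _,_; ∃; ∃-syntax; map₂)
open import Data.Vec.Base as Vec using (Vec; []; _∷_; lookup; removeAt)
open import Data.Vec.Membership.Propositional using (_∈_)
open import Data.Vec.Membership.Propositional.Properties using (∈-map⁺)
import Data.Vec.Membership.DecPropositional as DecMembership
open import Data.Vec.Properties using (≡-dec; removeAt-punchOut)
open import Data.Vec.Relation.Unary.All as VecAll using ([]; _∷_)
open import Data.Vec.Relation.Unary.AllPairs using (AllPairs; []; _∷_; allPairs?)
import Data.Vec.Relation.Unary.Any as VecAny
import Data.Vec.Relation.Unary.Any.Properties as VecAny
open import Data.Vec.Relation.Unary.Linked using ([-]; _∷_)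
open import Data.Vec.Relation.Unary.Unique.Propositional using (Unique)
open import Data.Vec.Relation.Unary.Unique.Propositional.Properties using (lookup-injective)
open import Function.Base using (_∘_; _$_)
open import Function.Bundles using (mk⇔; Equivalence; Injection; Inverse)
open import Function.Construct.Identity using (↔-id)
open import Function.Definitions using (Injective)
open import Function.Properties.Inverse using (↔⇒↣)
open import Level using (0ℓ)
open import Relation.Binary.Core using (Rel)
open import Relation.Binary.Definitions using (DecidableEquality; tri<; tri≈; tri>)
open import Relation.Binary.PropositionalEquality
open import Relation.Binary.Structures using (IsStrictTotalOrder)
open import Relation.Nullary using (¬_; Dec; yes; no; does; contradiction)
open import Relation.Nullary.Decidable using (¬?; ¬¬-excluded-middle; from-yes; _→-dec_)
open import Relation.Unary using (Pred)

private variable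
  A : Set
  k m n r : ℕ

-- Permutations and subsequences of a vector.

inserts : A → Vec A n → List (Vec A (suc n))
inserts x []       = (x ∷ []) ∷ []
inserts x (y ∷ ys) = (x ∷ y ∷ ys) ∷ map (y ∷_) (inserts x ys)

permutations : Vec A n → List (Vec A n)
permutations []       = [] ∷ []
permutations (x ∷ xs) = concatMap (inserts x) (permutations xs)

subsequences : ∀ k → Vec A n → List (Vec A k)
subsequences zero    _        = [] ∷ []
subsequences (suc k) []       = []
subsequences (suc k) (x ∷ xs) = map (x ∷_) (subsequences k xs) ++ subsequences (suc k) xs

inserts-All : ∀ {P : Pred A 0ℓ} {x} {ys : Vec A n} →
              P x → VecAll.All P ys → All (VecAll.All P) (inserts x ys)
inserts-All px []         = (px ∷ []) ∷ []
inserts-All px (py ∷ pys) = (px ∷ py ∷ pys) ∷ All.map⁺ (All.map (py ∷_) (inserts-All px pys))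

permutations-All : ∀ {P : Pred A 0ℓ} {xs : Vec A n} →
                   VecAll.All P xs → All (VecAll.All P) (permutations xs)
permutations-All []         = [] ∷ []
permutations-All (px ∷ pxs) =
  All.concat⁺ (All.map⁺ (All.map (inserts-All px) (permutations-All pxs)))

subsequences-All : ∀ {P : Pred A 0ℓ} k {xs : Vec A n} →
                   VecAll.All P xs → All (VecAll.All P) (subsequences k xs)
subsequences-All zero    _          = [] ∷ []
subsequences-All (suc k) []         = []
subsequences-All (suc k) (px ∷ pxs) =
  All.++⁺ (All.map⁺ (All.map (px ∷_) (subsequences-All k pxs))) (subsequences-All (suc k) pxs)

subsequences-AllPairs : ∀ {R : Rel A 0ℓ} k {xs : Vec A n} →
                        AllPairs R xs → All (AllPairs R) (subsequences k xs)
subsequences-AllPairs zero    _          = [] ∷ []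
subsequences-AllPairs (suc k) []         = []
subsequences-AllPairs (suc k) (rx ∷ rxs) =
  All.++⁺ (All.map⁺ (All.zipWith (λ (r , rs) → r ∷ rs)
                      (subsequences-All k rx , subsequences-AllPairs k rxs)))
          (subsequences-AllPairs (suc k) rxs)

module _ {_≺_ : Rel A 0ℓ} (sto : IsStrictTotalOrder _≡_ _≺_) where
  open IsStrictTotalOrder sto using (compare) renaming (trans to ≺-trans)

  inserts-sorted : ∀ {x} {ys : Vec A n} → VecAll.All (x ≢_) ys → AllPairs _≺_ ys →
                   Any (AllPairs _≺_) (inserts x ys)
  inserts-sorted                []          []            = here ([] ∷ [])
  inserts-sorted {x = x} {y ∷ _} (x≢y ∷ x∉ys) (y≺ys ∷ ys↗) with compare x y
  ... | tri< x≺y _ _ = here ((x≺y ∷ VecAll.map (≺-trans x≺y) y≺ys) ∷ y≺ys ∷ ys↗)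
  ... | tri≈ _ x≡y _ = contradiction x≡y x≢y
  ... | tri> _ _ y≺x = let zs , zs∈ , zs↗ = find (inserts-sorted x∉ys ys↗) in
    there (Any.map⁺ (lose zs∈ (All.lookup (inserts-All y≺x y≺ys) zs∈ ∷ zs↗)))

  -- Insertion sort stays inside the list: the tail is sorted first, then the head is inserted in
  -- its place. A check over the list thus covers every linear order.
  permutations-sorted : {xs : Vec A n} → Unique xs → Any (AllPairs _≺_) (permutations xs)
  permutations-sorted []           = here []
  permutations-sorted (x∉xs ∷ xs!) =
    let ys , ys∈ , ys↗ = find (permutations-sorted xs!) in
    Any.concatMap⁺ _ (lose ys∈ (inserts-sorted (All.lookup (permutations-All x∉xs) ys∈) ys↗))

_≟ᵛ_ : DecidableEquality (Vec (Fin n) k)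
_≟ᵛ_ = ≡-dec _≟_

infix 4 _≟ᵛ_ _∈?_

_∈?_ : (x : Fin n) (e : Vec (Fin n) k) → Dec (x ∈ e)
x ∈? e = DecMembership._∈?_ _≟_ x e

unique? : (e : Vec (Fin n) k) → Dec (Unique e)
unique? = allPairs? λ x y → ¬? (x ≟ y)

-- Upper bound

-- The orbits of three triples under the permutation (0 1 2 3)(4 5).
edges₆ : List (Vec (Fin 6) 3)
edges₆ =
  (0F ∷ 2F ∷ 1F ∷ []) ∷ (1F ∷ 3F ∷ 2F ∷ []) ∷ (2F ∷ 0F ∷ 3F ∷ []) ∷ (3F ∷ 1F ∷ 0F ∷ []) ∷
  (4F ∷ 0F ∷ 1F ∷ []) ∷ (5F ∷ 1F ∷ 2F ∷ []) ∷ (4F ∷ 2F ∷ 3F ∷ []) ∷ (5F ∷ 3F ∷ 0F ∷ []) ∷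
  (0F ∷ 1F ∷ 5F ∷ []) ∷ (1F ∷ 2F ∷ 4F ∷ []) ∷ (2F ∷ 3F ∷ 5F ∷ []) ∷ (3F ∷ 0F ∷ 4F ∷ []) ∷ []

abstract
  edges₆-unique : All Unique edges₆
  edges₆-unique = from-yes (all? unique? edges₆)

  -- Edges have three distinct entries, so inclusion in one direction already means equal sets.
  edges₆-determined : All (λ e → All (λ f → (∀ x → x ∈ e → x ∈ f) → e ≡ f) edges₆) edges₆
  edges₆-determined = from-yes
    (all? (λ e → all? (λ f → ∀? (λ x → x ∈? e →-dec x ∈? f) →-dec e ≟ᵛ f) edges₆) edges₆)

  -- A tuple is consistent with the order that lists the vertices as `p` exactly when it is a
  -- subsequence of `p`.
  edges₆-propertyO : All (λ p → Any (λ e → e List.∈ subsequences 3 p) edges₆)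
                         (permutations (Vec.allFin 6))
  edges₆-propertyO = from-yes
    (all? (λ p → Any.any? (λ e → Any.any? (e ≟ᵛ_) (subsequences 3 p)) edges₆)
          (permutations (Vec.allFin 6)))

H₆ : OrientedGraph 3
H₆ = record
  { V               = Fin 6
  ; size            = 6
  ; finite          = ↔-id _
  ; IsEdge          = List._∈ edges₆
  ; edge-distinct   = All.lookup edges₆-unique
  ; edge-determined = λ e∈ f∈ e≈f →
      All.lookup (All.lookup edges₆-determined e∈) f∈ (Equivalence.to ∘ e≈f)
  }

AllPairs⇒Consistent : ∀ {_≺_ : Rel A 0ℓ} {e : Vec A 3} → AllPairs _≺_ e → Consistent _≺_ e
AllPairs⇒Consistent ((x≺y ∷ _) ∷ (y≺z ∷ []) ∷ _) = x≺y ∷ y≺z ∷ [-]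

H₆-propertyO : PropertyO H₆
H₆-propertyO _≺_ sto =
  let p , p∈ , p↗ = find (permutations-sorted sto (from-yes (unique? (Vec.allFin 6))))
      e , e∈ , e⊆p = find (All.lookup edges₆-propertyO p∈)
  in e , e∈ , AllPairs⇒Consistent (All.lookup (subsequences-AllPairs 3 p↗) e⊆p)

-- Backtracking search

-- `E i c` reads: the edge set has letter `c` at position `i`. It is a relation because membership
-- in the edge set need not be decidable.
Hit : (Fin r → Fin k → Set) → Vec (Fin k) r → Set
Hit E w = ∃[ i ] E i (lookup w i)

-- What is left to hit once position `i` is settled with letter `c`: words with that letter there
-- are hit already, the others can no longer be hit there.
restrict : Fin (suc r) → Fin k → List (Vec (Fin k) (suc r)) → List (Vec (Fin k) r)
restrict i c []       = []
restrict i c (w ∷ ws) =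
  if does (lookup w i ≟ c) then restrict i c ws else removeAt w i ∷ restrict i c ws

-- `true` certifies that the words cannot all be hit. The first word must be hit somewhere, so each
-- position is tried; a word without positions is a contradiction.
branchOnWord : ∀ r → List (Vec (Fin k) r) → Bool
branchOnWord _       []         = false
branchOnWord zero    (_ ∷ _)    = true
branchOnWord (suc r) ws@(w ∷ _) =
  all (λ i → branchOnWord r (restrict i (lookup w i) ws)) (allFin (suc r))

branchOnLetter : ∀ d → List (Vec (Fin k) (d + r)) → Bool
branchOnLetter zero    ws = branchOnWord _ ws
branchOnLetter (suc d) ws = all (λ c → branchOnLetter d (restrict zero c ws)) (allFin _)

module _ (E : Fin (suc r) → Fin k → Set) (i : Fin (suc r)) {c : Fin k}
         (only-c : ∀ {c′} → E i c′ → c′ ≡ c) where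

  private E′ = E ∘ punchIn i

  -- `only-c` excludes a hit at `i`, so the hit lies elsewhere and survives. It holds both when the
  -- letter at `i` is `c` and when there is none.
  removeAt-Hit : ∀ w → Hit E w → lookup w i ≢ c → Hit E′ (removeAt w i)
  removeAt-Hit w (j , Ej) wi≢c with i ≟ j
  ... | yes refl = contradiction (only-c Ej) wi≢c
  ... | no  i≢j  = punchOut i≢j ,
    subst₂ E (sym (punchIn-punchOut i≢j)) (sym (removeAt-punchOut w i≢j)) Ej

  restrict-Hit : ∀ {ws} → All (Hit E) ws → All (Hit E′) (restrict i c ws)
  restrict-Hit              []       = []
  restrict-Hit {ws = w ∷ _} (h ∷ hs) with lookup w i ≟ c
  ... | yes _    = restrict-Hit hs
  ... | no  wi≢c = removeAt-Hit w h wi≢c ∷ restrict-Hit hs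

Functional : (Fin r → Fin k → Set) → Set
Functional E = ∀ i c c′ → E i c → E i c′ → c ≡ c′

-- The hit of the first word selects a branch that the search has refuted.
branchOnWord-sound : ∀ (ws : List (Vec (Fin k) r)) {E} → Functional E →
                     T (branchOnWord r ws) → ¬ All (Hit E) ws
branchOnWord-sound {r = zero}  (_ ∷ _)    fun t ((() , _) ∷ _)
branchOnWord-sound {r = suc r} ws@(w ∷ _) {E} fun t hs@((i , Ei) ∷ _) =
  branchOnWord-sound (restrict i (lookup w i) ws) (λ j → fun (punchIn i j))
    (All.lookup (All.all⁺ _ (allFin (suc r)) t) (∈-allFin i))
    (restrict-Hit E i (λ Ei′ → fun i _ _ Ei′ Ei) hs)

-- A position without a letter may be given any letter, because that only
-- discards words.
branchOnLetter-sound : ∀ d (ws : List (Vec (Fin (suc k)) (d + r))) {E} → Functional E →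
                       T (branchOnLetter d ws) → ¬ All (Hit E) ws
branchOnLetter-sound zero    ws fun t hs = branchOnWord-sound ws fun t hs
-- The goal is a negation, which permits a case distinction on the undecided existence of a letter.
branchOnLetter-sound {k = k} (suc d) ws {E} fun t hs = ¬¬-excluded-middle {A = ∃ (E zero)} λ where
    (yes (c , E0c)) → refute c λ E0c′ → fun zero _ _ E0c′ E0c
    (no ¬E0)        → refute zero λ E0c → contradiction (_ , E0c) ¬E0
  where
  refute : ∀ c → ¬ (∀ {c′} → E zero c′ → c′ ≡ c)
  refute c only-c = branchOnLetter-sound d (restrict zero c ws) (λ j → fun (suc j))
    (All.lookup (All.all⁺ _ (allFin (suc k)) t) (∈-allFin c))
    (restrict-Hit E zero only-c hs)

module _ (E : Fin (suc (m + r)) → Fin (suc k) → Set) (fun : Functional E) where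

  -- A known letter at the first position replaces the branching there by a single case.
  branchOnLetter-sound-given-zero : ∀ {word : A → Vec (Fin (suc k)) (suc (m + r))} {ps c} →
    T (branchOnLetter m (restrict zero c (map word ps))) → E zero c → ¬ All (Hit E ∘ word) ps
  branchOnLetter-sound-given-zero t E0c hits = branchOnLetter-sound m _ (λ j → fun (suc j)) t
    (restrict-Hit E zero (λ E0c′ → fun zero _ _ E0c′ E0c) (All.map⁺ hits))

-- Lower bound

arrangements : Vec A 3 → Vec (Vec A 3) 6
arrangements (x ∷ y ∷ z ∷ []) =
  (x ∷ y ∷ z ∷ []) ∷ (x ∷ z ∷ y ∷ []) ∷ (z ∷ x ∷ y ∷ []) ∷
  (y ∷ x ∷ z ∷ []) ∷ (y ∷ z ∷ x ∷ []) ∷ (z ∷ y ∷ x ∷ []) ∷ []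

-- The index in arrangements e of the arrangement with increasing ranks.
letter : (Fin n → Fin m) → Vec (Fin n) 3 → Fin 6
letter rank (x ∷ y ∷ z ∷ []) = code (x ≺ y) (y ≺ z) (x ≺ z)
  where
  _≺_ : _ → _ → Bool
  x ≺ y = does (rank x <? rank y)
  code : Bool → Bool → Bool → Fin 6
  code true  true  _     = 0F
  code true  false true  = 1F
  code true  false false = 2F
  code false true  true  = 3F
  code false true  false = 4F
  code false false _     = 5F

triples : Vec (Vec (Fin 5) 3) 10
triples = Vec.fromList (subsequences 3 (Vec.allFin 5))

triple : Fin 10 → Fin 6 → Vec (Fin 5) 3
triple i c = lookup (arrangements (lookup triples i)) c

-- Here `p` is a table of ranks, `lookup p x` being the rank of `x`, and not an increasing listing
-- as in the upper bound.
word : Vec (Fin 5) 5 → Vec (Fin 6) 10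
word p = Vec.map (letter (lookup p)) triples

rankings : List (Vec (Fin 5) 5)
rankings = permutations (Vec.allFin 5)

abstract
  rankings-unique : All Unique rankings
  rankings-unique = from-yes (all? unique? rankings)

  triple-injective : ∀ i c c′ → triple i c ≡ triple i c′ → c ≡ c′
  triple-injective = from-yes
    (∀? λ i → ∀? λ c → ∀? λ c′ → triple i c ≟ᵛ triple i c′ →-dec c ≟ c′)

  triple-∈ : ∀ i c c′ x → x ∈ triple i c → x ∈ triple i c′
  triple-∈ = from-yes
    (∀? λ i → ∀? λ c → ∀? λ c′ → ∀? λ x → x ∈? triple i c →-dec x ∈? triple i c′)

  word-complete : All (λ p → ∀ x y z → lookup p x < lookup p y → lookup p y < lookup p z →
                             ∃[ i ] triple i (lookup (word p) i) ≡ x ∷ y ∷ z ∷ []) rankings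
  word-complete = from-yes (all? (λ p → ∀? λ x → ∀? λ y → ∀? λ z →
    lookup p x <? lookup p y →-dec lookup p y <? lookup p z →-dec
    any? λ i → triple i (lookup (word p) i) ≟ᵛ x ∷ y ∷ z ∷ []) rankings)

  -- `triple 0F 0F` is (0,1,2). This supplies the letter with which the search starts.
  relabelling : ∀ x y z → x < y → y < z →
                Any (λ p → Vec.map (lookup p) (x ∷ y ∷ z ∷ []) ≡ triple 0F 0F) rankings
  relabelling = from-yes (∀? λ x → ∀? λ y → ∀? λ z → x <? y →-dec y <? z →-dec
    Any.any? (λ p → Vec.map (lookup p) (x ∷ y ∷ z ∷ []) ≟ᵛ triple 0F 0F) rankings)

-- Four levels of branching on the letter leave five positions, where a word
-- has fewer positions than there are letters.
¬all-Hit-rankings : (E : Fin 10 → Fin 6 → Set) → Functional E →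
                    E 0F 0F → ¬ All (Hit E ∘ word) rankings
¬all-Hit-rankings E fun = branchOnLetter-sound-given-zero {m = 4} {r = 5} E fun
  {word = word} {rankings} {0F} _

pullback-isStrictTotalOrder : {f : A → Fin n} → Injective _≡_ _≡_ f →
                              IsStrictTotalOrder _≡_ (λ x y → f x < f y)
pullback-isStrictTotalOrder {f = f} inj = record
  { isStrictPartialOrder = record
    { isEquivalence = isEquivalence
    ; irrefl        = λ { refl → <-irrefl refl }
    ; trans         = <-trans
    ; <-resp-≈      = resp₂ _
    }
  ; compare = compare
  }
  where
  compare : ∀ x y → _
  compare x y with <-cmp (f x) (f y)
  ... | tri< a b c = tri< a (b ∘ cong f) c
  ... | tri≈ a b c = tri≈ a (inj b) c
  ... | tri> a b c = tri> a (b ∘ cong f) c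

module _ (H : OrientedGraph 3) (O : PropertyO H) where
  open OrientedGraph H

  ¬labelled : {f : V → Fin 5} → Injective _≡_ _≡_ f →
              ∀ {e} → IsEdge e → Vec.map f e ≢ triple 0F 0F
  ¬labelled {f} f-inj {e₀} e₀-edge fe₀≡ =
    ¬all-Hit-rankings E functional (e₀ , e₀-edge , fe₀≡) (All.tabulate hit)
    where
    -- If `f` misses a label, the positions whose subset contains it have no letter.
    E : Fin 10 → Fin 6 → Set
    E i c = ∃[ e ] IsEdge e × Vec.map f e ≡ triple i c

    ⊆ : ∀ i c c′ {e e′} → Vec.map f e ≡ triple i c → Vec.map f e′ ≡ triple i c′ →
        ∀ {x} → x ∈ e → x ∈ e′
    ⊆ i c c′ eq eq′ {x} x∈e = VecAny.map f-inj (VecAny.map⁻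
      (subst (f x ∈_) (sym eq′) (triple-∈ i c c′ (f x) (subst (f x ∈_) eq (∈-map⁺ f x∈e)))))

    -- Both edges map to arrangements of one 3-subset, so by injectivity of `f` they have the same
    -- entries and `edge-determined` applies.
    functional : Functional E
    functional i c c′ (e , e-edge , eq) (e′ , e′-edge , eq′) =
      triple-injective i c c′ $ trans (sym eq) $ trans (cong (Vec.map f) e≡e′) eq′
      where e≡e′ = edge-determined e-edge e′-edge (λ _ → mk⇔ (⊆ i c c′ eq eq′) (⊆ i c′ c eq′ eq))

    hit : ∀ {p} → p List.∈ rankings → Hit E (word p)
    hit {p} p∈ = locate (O _ (pullback-isStrictTotalOrder
                               (f-inj ∘ lookup-injective (All.lookup rankings-unique p∈) _ _)))
      where
      locate : (∃[ e ] IsEdge e × Consistent (λ x y → lookup p (f x) < lookup p (f y)) e) →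
               Hit E (word p)
      locate (e@(x ∷ y ∷ z ∷ []) , e-edge , x<y ∷ y<z ∷ [-]) =
        map₂ (λ eq → e , e-edge , sym eq)
             (All.lookup word-complete p∈ (f x) (f y) (f z) x<y y<z)

  ¬size≤5 : ¬ size ≤ 5
  -- Property O serves first to produce some edge, increasing in the labels `g`; composing `g` with
  -- a ranking carries it to (0,1,2).
  ¬size≤5 size≤5 = relabel (O _ (pullback-isStrictTotalOrder g-inj))
    where
    g : V → Fin 5
    g x = inject≤ (Inverse.to finite x) size≤5

    g-inj : Injective _≡_ _≡_ g
    g-inj = Injection.injective (↔⇒↣ finite) ∘ inject≤-injective _ _ _ _

    relabel : ¬ (∃[ e ] IsEdge e × Consistent (λ x y → g x < g y) e)
    relabel (x ∷ y ∷ z ∷ [] , e-edge , x<y ∷ y<z ∷ [-]) =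
      let p , p∈ , eq = find (relabelling _ _ _ x<y y<z)
      in ¬labelled (g-inj ∘ lookup-injective (All.lookup rankings-unique p∈) _ _) e-edge eq

mainTheorem2 : n[ 3 ]≡ 6
mainTheorem2 = (H₆ , refl , H₆-propertyO) ,
  λ { _ (H , refl , O) → ≮⇒≥ λ size<6 → ¬size≤5 H O (s≤s⁻¹ size<6) }
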